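{- Let $k\ge 0$ be an integer. For any graph $G$, \[\gamma_P(G)+k\leq \ddot{\gamma}_P^k(G)\leq (k+1)\gamma_P(G).\]
   Context: All graphs are finite, simple, undirected, with nonempty vertex set. For $S\subseteq V(G)$ the power domination process is: (1) start with the observed set $N[S]$ (the union of closed neighborhoods of vertices of $S$); (2) while some observed vertex has exactly one unobserved neighbor $w$, add $w$ to the observed set. $S$ is a power dominating set if eventually all vertices are observed. $\gamma_P(G)$ is the minimum cardinality of a power dominating set. For an integer $k\ge 0$, a multiset $S$ of vertices of $G$ is a $k$-PMU-defect-robust power dominating set ($k$-rPDS) if $|S|\ge k$ and for every submultiset $F$ of $S$ with $|F|=k$, the underlying set of $S\setminus F$ (multiset difference) contains a power dominating set of $G$. Cardinalities of multisets count multiplicity. $\ddot{\gamma}_P^k(G)$ is the minimum cardinality of a $k$-rPDS of $G$. -}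

module Defs where

open import Data.Fin.Base using (Fin)
open import Data.Fin.Properties using (any?; all?) renaming (_≟_ to _≟ᶠ_)
open import Data.Fin.Subset
  using (Subset; _∈_; _∉_; _⊆_; _⊃_; _∪_; ⁅_⁆; ⊤; ∣_∣)
open import Data.Fin.Subset.Properties
  using (_∈?_; _⊆?_; anySubset?; ∈⊤; ⊆⊤; ⊆-antisym; x∈⁅x⁆; x∈⁅y⁆⇒x≡y;
         x∈p∪q⁻; x∈p∪q⁺; p⊆p∪q)
open import Data.Fin.Subset.Induction using (⊃-wellFounded; Acc; acc)
open import Data.Nat.Base
open import Data.Nat.Properties
open import Data.Product.Base using (∃; ∃-syntax; _×_; _,_; proj₁; proj₂)
open import Data.Sum.Base using (_⊎_; inj₁; inj₂)
open import Data.Vec.Base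
  using (Vec; []; _∷_; map; replicate; sum; tabulate; zipWith)
open import Data.Vec.Properties
  using (lookup∘tabulate; lookup⇒[]=)
open import Data.Vec.Relation.Binary.Pointwise.Inductive as Pointwise
  using (Pointwise)
open import Function.Base using (_∘_)
open import Level using (0ℓ)
open import Relation.Binary.Core using (Rel)
import Relation.Binary.Definitions as B
open import Relation.Binary.Construct.Closure.ReflexiveTransitive
  using (Star; ε; _◅_)
open import Relation.Binary.PropositionalEquality
open import Relation.Nullary
open import Relation.Nullary.Decidable
  using (map′; _×-dec_; _⊎-dec_; _→-dec_; ¬?; decidable-stable; dec-true)
open import Relation.Unary using (Decidable)

IsMinimum : (ℕ → Set) → ℕ → Set
IsMinimum P m = P m × (∀ {j} → P j → m ≤ j)

module _ {P : ℕ → Set} (P? : Decidable P) where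

  private
    search : ∀ fuel i → (∀ {j} → P j → i ≤ j) → P (i + fuel) →
             ∃ (IsMinimum P)
    search zero i lb p = i , subst P (+-identityʳ i) p , lb
    search (suc fuel) i lb p with P? i
    ... | yes pi = i , pi , lb
    ... | no ¬pi = search fuel (suc i) lb′ (subst P (+-suc i fuel) p)
      where
      lb′ : ∀ {j} → P j → suc i ≤ j
      lb′ pj = ≤∧≢⇒< (lb pj) λ { refl → ¬pi pj }

  minimum : ∃ P → ∃ (IsMinimum P)
  minimum (m , p) = search m 0 (λ _ → z≤n) p

record Graph : Set₁ where
  field
    order : ℕ
    .{{nonempty}} : NonZero order

  V : Set
  V = Fin order

  field
    Adj    : Rel V 0ℓ
    adj?   : B.Decidable Adj
    symm   : B.Symmetric Adj
    irrefl : B.Irreflexive _≡_ Adj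

-- Multisets of elements of Fin n, as vectors of multiplicities.
Multiset : ℕ → Set
Multiset = Vec ℕ

card : ∀ {n} → Multiset n → ℕ
card = sum

infix 4 _⊑_
_⊑_ : ∀ {n} → Rel (Multiset n) 0ℓ
_⊑_ = Pointwise _≤_

infixl 6 _∖_
_∖_ : ∀ {n} → Multiset n → Multiset n → Multiset n
_∖_ = zipWith _∸_

support : ∀ {n} → Multiset n → Subset n
support = map (0 <ᵇ_)

private
  anyMultiset? : ∀ {n} {P : Multiset n → Set} → Decidable P →
                 ∀ m → Dec (∃[ S ] card S ≡ m × P S)
  anyMultiset? {zero} P? m =
    map′ (λ { (e , p) → [] , e , p }) (λ { ([] , e , p) → e , p })
         (0 ≟ m ×-dec P? [])
  anyMultiset? {suc n} P? m =
    map′ (λ { (a , s≤s a≤m , S , e , p) →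
              a ∷ S , trans (cong (a +_) e) (m+[n∸m]≡n a≤m) , p })
         (λ { (a ∷ S , refl , p) →
              a , s≤s (m≤m+n a _) , S , sym (m+n∸m≡n a _) , p })
         (anyUpTo? (λ a → anyMultiset? (λ S → P? (a ∷ S)) (m ∸ a)) (suc m))

  allMultiset? : ∀ {n} {P : Multiset n → Set} → Decidable P →
                 ∀ m → Dec (∀ S → card S ≡ m → P S)
  allMultiset? P? m =
    map′ (λ h S e → decidable-stable (P? S) λ ¬p → h (S , e , ¬p))
         (λ h (S , e , ¬p) → ¬p (h S e))
         (¬? (anyMultiset? (λ S → ¬? (P? S)) m))

module _ (G : Graph) where
  open Graph G

  dominated? : ∀ S w → Dec (∃[ v ] v ∈ S × (v ≡ w ⊎ Adj v w))
  dominated? S w = any? λ v → v ∈? S ×-dec (v ≟ᶠ w ⊎-dec adj? v w)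

  N[_] : Subset order → Subset order
  N[ S ] = tabulate λ w → does (dominated? S w)

  UniqueUnobservedNeighbour : Subset order → V → V → Set
  UniqueUnobservedNeighbour O u w =
    (Adj u w × w ∉ O) × (∀ x → Adj u x → x ∉ O → x ≡ w)

  infix 4 _⟶_
  data _⟶_ (O : Subset order) : Subset order → Set where
    observe : ∀ {u w} → u ∈ O → UniqueUnobservedNeighbour O u w →
              O ⟶ O ∪ ⁅ w ⁆

  -- The choices made along a run do not affect the final observed set
  -- (`stuck-bound` below), so asking for some complete run is the same
  -- as asking that every maximal run observe all vertices.
  IsPDS : Subset order → Set
  IsPDS S = Star _⟶_ N[ S ] ⊤

  -- k-PMU-defect-robust power dominating sets
  IsRPDS : ℕ → Multiset order → Set
  IsRPDS k S =
    k ≤ card S ×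
    (∀ F → card F ≡ k → F ⊑ S → ∃[ T ] T ⊆ support (S ∖ F) × IsPDS T)

  HasPDSOfSize : ℕ → Set
  HasPDSOfSize m = ∃[ S ] IsPDS S × ∣ S ∣ ≡ m

  HasRPDSOfSize : ℕ → ℕ → Set
  HasRPDSOfSize k m = ∃[ S ] card S ≡ m × IsRPDS k S

  stuck-bound : ∀ {O X Y} → (∀ {O′} → ¬ (O ⟶ O′)) →
                X ⊆ O → Star _⟶_ X Y → Y ⊆ O
  stuck-bound stuck X⊆O ε = X⊆O
  stuck-bound {O} {X} stuck X⊆O
              (observe {u} {w} u∈X ((uw , w∉X) , uniq) ◅ run) =
    stuck-bound stuck X∪w⊆O run
    where
    w∈O : w ∈ O
    w∈O = decidable-stable (w ∈? O) λ w∉O →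
      stuck (observe (X⊆O u∈X)
        ((uw , w∉O) , λ x ux x∉O → uniq x ux (x∉O ∘ X⊆O)))

    X∪w⊆O : X ∪ ⁅ w ⁆ ⊆ O
    X∪w⊆O x∈ with x∈p∪q⁻ X ⁅ w ⁆ x∈
    ... | inj₁ x∈X = X⊆O x∈X
    ... | inj₂ x∈w rewrite x∈⁅y⁆⇒x≡y _ x∈w = w∈O

  private
    step? : ∀ O → Dec (∃ (O ⟶_))
    step? O =
      map′ (λ { (u , w , u∈O , uniq) → _ , observe u∈O uniq })
           (λ { (_ , observe u∈O uniq) → _ , _ , u∈O , uniq })
           (any? λ u → any? λ w → u ∈? O ×-dec
             ((adj? u w ×-dec ¬? (w ∈? O)) ×-dec
              all? λ x → adj? u x →-dec (¬? (x ∈? O) →-dec x ≟ᶠ w)))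

    closure : ∀ O → Acc _⊃_ O →
              ∃[ C ] Star _⟶_ O C × (∀ {C′} → ¬ (C ⟶ C′))
    closure O (acc rs) with step? O
    ... | no ¬s = O , ε , λ s → ¬s (_ , s)
    ... | yes (_ , s@(observe {w = w} u∈O ((_ , w∉O) , _)))
      with closure _ (rs (p⊆p∪q _ , w , x∈p∪q⁺ (inj₂ (x∈⁅x⁆ w)) , w∉O))
    ... | C , run , stuck = C , s ◅ run , stuck

  isPDS? : Decidable IsPDS
  isPDS? S with closure N[ S ] (⊃-wellFounded N[ S ])
  ... | C , run , stuck with ⊤ ⊆? C
  ...   | yes ⊤⊆C = yes (subst (Star _⟶_ N[ S ]) (⊆-antisym ⊆⊤ ⊤⊆C) run)
  ...   | no  ⊤⊈C = no λ full → ⊤⊈C (stuck-bound stuck (run-⊆ run) full)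
    where
    run-⊆ : ∀ {X Y} → Star _⟶_ X Y → X ⊆ Y
    run-⊆ ε x∈ = x∈
    run-⊆ (observe _ _ ◅ r) x∈ = run-⊆ r (p⊆p∪q _ x∈)

  hasPDSOfSize? : Decidable HasPDSOfSize
  hasPDSOfSize? m = anySubset? λ S → isPDS? S ×-dec ∣ S ∣ ≟ m

  isRPDS? : ∀ k → Decidable (IsRPDS k)
  isRPDS? k S =
    k ≤? card S ×-dec
    allMultiset? (λ F →
      Pointwise.decidable _≤?_ F S →-dec
      anySubset? λ T → T ⊆? support (S ∖ F) ×-dec isPDS? T) k

  hasRPDSOfSize? : ∀ k → Decidable (HasRPDSOfSize k)
  hasRPDSOfSize? k = anyMultiset? (isRPDS? k)

  private
    ⊤-isPDS : IsPDS ⊤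
    ⊤-isPDS = subst (λ X → Star _⟶_ X ⊤) (sym N[⊤]≡⊤) ε
      where
      N[⊤]≡⊤ : N[ ⊤ ] ≡ ⊤
      N[⊤]≡⊤ = ⊆-antisym ⊆⊤ λ {w} _ → lookup⇒[]= w N[ ⊤ ]
        (trans (lookup∘tabulate _ w) (dec-true (dominated? ⊤ w) (w , ∈⊤ , inj₁ refl)))

    support-replicate : ∀ {n} k (F : Multiset n) → card F ≤ k →
                        support (replicate n (suc k) ∖ F) ≡ ⊤
    support-replicate k [] _ = refl
    support-replicate k (c ∷ F) le = cong₂ _∷_
      (cong (0 <ᵇ_) (+-∸-assoc 1 (m+n≤o⇒m≤o c le)))
      (support-replicate k F (m+n≤o⇒n≤o c le))

    ≤-card-replicate : ∀ n .{{_ : NonZero n}} k → k ≤ card (replicate n (suc k))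
    ≤-card-replicate (suc n) k = ≤-trans (n≤1+n k) (m≤m+n (suc k) _)

  hasPDS : ∃ HasPDSOfSize
  hasPDS = _ , ⊤ , ⊤-isPDS , refl

  hasRPDS : ∀ k → ∃ (HasRPDSOfSize k)
  hasRPDS k = _ , replicate order (suc k) , refl , ≤-card-replicate order k ,
    λ F e _ → ⊤ ,
      subst (⊤ ⊆_) (sym (support-replicate k F (≤-reflexive e))) (λ x∈ → x∈) ,
      ⊤-isPDS

γP : Graph → ℕ
γP G = proj₁ (minimum (hasPDSOfSize? G) (hasPDS G))

γP-isMinimum : ∀ G → IsMinimum (HasPDSOfSize G) (γP G)
γP-isMinimum G = proj₂ (minimum (hasPDSOfSize? G) (hasPDS G))

γ̈P : ℕ → Graph → ℕ
γ̈P k G = proj₁ (minimum (hasRPDSOfSize? G k) (hasRPDS G k))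

γ̈P-isMinimum : ∀ k G → IsMinimum (HasRPDSOfSize G k) (γ̈P k G)
γ̈P-isMinimum k G = proj₂ (minimum (hasRPDSOfSize? G k) (hasRPDS G k))

{-# OPTIONS --safe #-}

-- Deleting any k elements from a k-rPDS leaves a multiset whose support
-- contains a power dominating set, which gives the lower bound.  Conversely,
-- k + 1 copies of each vertex of a minimum power dominating set T form a
-- k-rPDS, since k deletions cannot exhaust the copies of a vertex; its
-- cardinality is at least k because T is nonempty.

module Submission where

open import Defs
open import Data.Nat.Base using (ℕ; _+_; _*_; _≤_)
open import Data.Product.Base using (_×_)
open import Algebra.Properties.CommutativeSemigroup using (interchange)
open import Data.Bool.Base using (if_then_else_)
open import Data.Fin.Base using (fromℕ<)
open import Data.Fin.Subset
  using (Subset; Nonempty; inside; outside; ⊤; ∣_∣)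
open import Data.Fin.Subset.Properties using (∈⊤; p⊆q⇒∣p∣≤∣q∣; ⊆-reflexive)
open import Data.Nat.Base
  using (zero; suc; z≤n; s≤s; _∸_; _⊓_; _<ᵇ_; NonZero; >-nonZero; >-nonZero⁻¹)
open import Data.Nat.Properties
open import Data.Product.Base using (∃-syntax; _,_; proj₁; proj₂)
open import Data.Vec.Base using ([]; _∷_; map; here; there)
open import Data.Vec.Properties using (lookup∘tabulate; []=⇒lookup)
open import Data.Vec.Relation.Binary.Pointwise.Inductive using ([]; _∷_)
open import Relation.Binary.Construct.Closure.ReflexiveTransitive
  using (Star; ε; _◅_)
open import Relation.Binary.PropositionalEquality
open import Relation.Nullary.Decidable.Core using (does; yes)

∣support∣≤card : ∀ {n} (S : Multiset n) → ∣ support S ∣ ≤ card S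
∣support∣≤card []          = z≤n
∣support∣≤card (zero  ∷ S) = ∣support∣≤card S
∣support∣≤card (suc a ∷ S) = s≤s (m≤n⇒m≤o+n a (∣support∣≤card S))

-- Supplies the k deletions to feed to robustness. The choice is greedy: each entry gives up as many
-- copies as are still wanted, `a ⊓ k`, and the tail owes the remaining `k ∸ a`.
∃⊑-card≡ : ∀ {n} k (S : Multiset n) → k ≤ card S →
           ∃[ F ] card F ≡ k × F ⊑ S
∃⊑-card≡ k []      z≤n = [] , refl , []
∃⊑-card≡ k (a ∷ S) k≤ with ∃⊑-card≡ (k ∸ a) S (m≤n+o⇒m∸n≤o k a k≤)
... | F , eq , F⊑S =
  a ⊓ k ∷ F , trans (cong (a ⊓ k +_) eq) (m⊓n+n∸m≡n a k) , m⊓n≤m a k ∷ F⊑S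

card-∖ : ∀ {n} {F S : Multiset n} → F ⊑ S → card (S ∖ F) + card F ≡ card S
card-∖ []                                  = refl
card-∖ {F = b ∷ F} {a ∷ S} (b≤a ∷ F⊑S) =
  trans (interchange +-commutativeSemigroup (a ∸ b) _ b _)
        (cong₂ _+_ (m∸n+n≡m b≤a) (card-∖ F⊑S))

copies : ∀ {n} → ℕ → Subset n → Multiset n
copies c = map (λ b → if b then c else 0)

card-copies : ∀ {n} c (T : Subset n) → card (copies c T) ≡ c * ∣ T ∣
card-copies c []            = sym (*-zeroʳ c)
card-copies c (outside ∷ T) = card-copies c T
card-copies c (inside  ∷ T) =
  trans (cong (c +_) (card-copies c T)) (sym (*-suc c ∣ T ∣))

support-copies-∖ : ∀ {n} k (T : Subset n) (F : Multiset n) → card F ≤ k →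
                   support (copies (suc k) T ∖ F) ≡ T
support-copies-∖ k []            []      _  = refl
support-copies-∖ k (outside ∷ T) (c ∷ F) le = cong₂ _∷_
  (cong (0 <ᵇ_) (0∸n≡0 c))
  (support-copies-∖ k T F (m+n≤o⇒n≤o c le))
support-copies-∖ k (inside  ∷ T) (c ∷ F) le = cong₂ _∷_
  -- One entry of `F` is at most `card F`, so `c ≤ k` and `suc k ∸ c` equals `suc (k ∸ c)`, which is
  -- visibly positive.
  (cong (0 <ᵇ_) (+-∸-assoc 1 (m+n≤o⇒m≤o c le)))
  (support-copies-∖ k T F (m+n≤o⇒n≤o c le))

Nonempty⇒∣p∣>0 : ∀ {n} {p : Subset n} → Nonempty p → 1 ≤ ∣ p ∣
Nonempty⇒∣p∣>0 (_ , here) = s≤s z≤n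
Nonempty⇒∣p∣>0 {p = inside  ∷ p} (_ , there x∈p) = s≤s z≤n
Nonempty⇒∣p∣>0 {p = outside ∷ p} (_ , there x∈p) = Nonempty⇒∣p∣>0 (_ , x∈p)

module _ (G : Graph) where
  open Graph G

  -- A first step is triggered by an already observed vertex; with no step, `O` is `⊤`, inhabited
  -- because the graph has a vertex.
  run-to-⊤⇒Nonempty : ∀ {O} → Star (_⟶_ G) O ⊤ → Nonempty O
  run-to-⊤⇒Nonempty ε                   = fromℕ< (>-nonZero⁻¹ order) , ∈⊤
  run-to-⊤⇒Nonempty (observe u∈O _ ◅ _) = _ , u∈O

  N[]-Nonempty⁻ : ∀ {S} → Nonempty (N[_] G S) → Nonempty S
  N[]-Nonempty⁻ {S} (w , w∈)
    with dominated? G S w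
       | trans (sym (lookup∘tabulate (λ w → does (dominated? G S w)) w))
               ([]=⇒lookup w∈)
  -- In the `no` case the abstracted equation would identify `outside` with `inside`, so only `yes`
  -- remains.
  ... | yes (v , v∈S , _) | _ = v , v∈S

  IsPDS⇒Nonempty : ∀ {S} → IsPDS G S → Nonempty S
  IsPDS⇒Nonempty pds = N[]-Nonempty⁻ (run-to-⊤⇒Nonempty pds)

  γP+k≤card : ∀ {k S} → IsRPDS G k S → γP G + k ≤ card S
  γP+k≤card {k} {S} (k≤ , robust) with ∃⊑-card≡ k S k≤
  -- A single deletion `F` suffices. Matching `refl` turns `k` into `card F`, the form in which
  -- `card-∖` ends the chain.
  ... | F , refl , F⊑S with robust F refl F⊑S
  ...   | T , T⊆ , pds = begin
    γP G + card F                ≤⟨ +-monoˡ-≤ _ (proj₂ (γP-isMinimum G) (T , pds , refl)) ⟩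
    ∣ T ∣ + card F               ≤⟨ +-monoˡ-≤ _ (p⊆q⇒∣p∣≤∣q∣ T⊆) ⟩
    ∣ support (S ∖ F) ∣ + card F ≤⟨ +-monoˡ-≤ _ (∣support∣≤card (S ∖ F)) ⟩
    card (S ∖ F) + card F        ≡⟨ card-∖ F⊑S ⟩
    card S                       ∎
    where open ≤-Reasoning

  copies-isRPDS : ∀ k {T} → IsPDS G T → IsRPDS G k (copies (suc k) T)
  copies-isRPDS k {T} pds =
    (begin
      k                       ≤⟨ n≤1+n k ⟩
      -- Uses the instance `∣T∣≢0`: with `T` empty there would be no copies at all.
      suc k                   ≤⟨ m≤m*n (suc k) ∣ T ∣ ⟩
      suc k * ∣ T ∣           ≡⟨ card-copies (suc k) T ⟨
      card (copies (suc k) T) ∎) ,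
    λ F e _ →
      T , ⊆-reflexive (sym (support-copies-∖ k T F (≤-reflexive e))) , pds
    where
    open ≤-Reasoning
    instance
      ∣T∣≢0 : NonZero ∣ T ∣
      ∣T∣≢0 = >-nonZero (Nonempty⇒∣p∣>0 (IsPDS⇒Nonempty pds))

proposition2 : (k : ℕ) (G : Graph) →
    (γP G + k ≤ γ̈P k G) × (γ̈P k G ≤ (k + 1) * γP G)
proposition2 k G = lower , upper
  where
  lower : γP G + k ≤ γ̈P k G
  lower with proj₁ (γ̈P-isMinimum k G)
  ... | S , card≡ , rpds = subst (γP G + k ≤_) card≡ (γP+k≤card G rpds)

  upper : γ̈P k G ≤ (k + 1) * γP G
  upper with proj₁ (γP-isMinimum G)
  ... | T , pds , size = proj₂ (γ̈P-isMinimum k G)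
    ( copies (suc k) T
    , trans (card-copies (suc k) T) (cong₂ _*_ (+-comm 1 k) size)
    , copies-isRPDS G k pds )
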